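{- Let $m\geq 1$ be an integer, let $G$ be the multigraph obtained from the complete graph $K_5$ by replacing each edge with $m$ parallel edges, and let $\Sigma=(G,\sigma)$ be a signed multigraph in which exactly one edge is positive and all remaining edges are negative. Then $$\chi'(\Sigma)=\Delta(G)+\mu(G)=5m.$$
   Context: Multigraphs are finite and loopless; parallel edges are allowed. $\Delta(G)$ is the maximum degree of $G$, and $\mu(G)$ is the maximum, over pairs of distinct vertices $u,v$, of the number of edges joining $u$ and $v$. A signed multigraph $\Sigma=(G,\sigma)$ consists of a multigraph $G$ and a signature $\sigma:E(G)\to\{1,-1\}$; an edge $e$ is positive if $\sigma(e)=1$ and negative if $\sigma(e)=-1$. Each edge $e=uv$ consists of two half-edges: $h_e^u$ at $u$ and $h_e^v$ at $v$. $H(G)$ is the set of all half-edges of $G$, and $H_G(v)$ the set of half-edges at $v$. For a nonnegative integer $k$, let $M_k=\{ -r,\dots,-1\}\cup\{1,\dots,r\}$ if $k=2r$, and $M_k=\{ -r,\dots,r\}$ (including $0$) if $k=2r+1$. A $k$-edge-coloring of $\Sigma$ is a mapping $\gamma:H(G)\to M_k$ such that the colors of the half-edges in $H_G(v)$ are pairwise distinct for every $v\in V(G)$, and $\gamma(h_e^u)=-\sigma(e)\gamma(h_e^v)$ for every edge $e=uv\in E(G)$. The chromatic index $\chi'(\Sigma)$ is the least nonnegative integer $k$ for which $\Sigma$ has a $k$-edge-coloring. -}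

module Defs where

open import Data.Nat.Base using (ℕ; _+_; _*_; _≤_)
open import Data.Integer.Base as ℤ using (ℤ; +_; -_)
open import Data.Sign.Base using (Sign)
open import Data.Fin.Base as Fin using (Fin; zero; suc; opposite; remQuot)
open import Data.Fin.Properties using (_≟_; _<?_; <⇒≢)
open import Data.List.Base using (List; map; filter; length; lookup; allFin; cartesianProduct)
open import Data.List.Extrema.Nat using (max)
open import Data.List.Membership.Propositional.Properties using (∈-lookup)
open import Data.List.Relation.Unary.All as All using (All)
open import Data.List.Relation.Unary.All.Properties using (all-filter)
open import Data.Product.Base using (_×_; _,_; ∃; proj₁; proj₂)
open import Data.Sum.Base using (_⊎_)
open import Relation.Binary.PropositionalEquality using (_≡_; _≢_)
open import Relation.Nullary.Decidable using (Dec; ¬?; _×-dec_; _⊎-dec_)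

-- The order of the two ends of an edge only serves to name its half-edges.
record Multigraph : Set where
  field
    #V       : ℕ
    #E       : ℕ
    end      : Fin #E → Fin 2 → Fin #V
    loopless : ∀ e → end e zero ≢ end e (suc zero)

  Vertex : Set
  Vertex = Fin #V

  Edge : Set
  Edge = Fin #E

  HalfEdge : Set
  HalfEdge = Edge × Fin 2

  vertexOf : HalfEdge → Vertex
  vertexOf (e , i) = end e i

  edgeOf : HalfEdge → Edge
  edgeOf = proj₁

  otherHalf : HalfEdge → HalfEdge
  otherHalf (e , i) = e , opposite i

  Joins : Vertex → Vertex → Edge → Set
  Joins u v e = (end e zero ≡ u × end e (suc zero) ≡ v)
              ⊎ (end e zero ≡ v × end e (suc zero) ≡ u)

  joins? : ∀ u v e → Dec (Joins u v e)
  joins? u v e = ((end e zero ≟ u) ×-dec (end e (suc zero) ≟ v))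
           ⊎-dec ((end e zero ≟ v) ×-dec (end e (suc zero) ≟ u))

  halfEdges : List HalfEdge
  halfEdges = cartesianProduct (allFin #E) (allFin 2)

  degree : Vertex → ℕ
  degree v = length (filter (λ h → vertexOf h ≟ v) halfEdges)

  multiplicity : Vertex → Vertex → ℕ
  multiplicity u v = length (filter (joins? u v) (allFin #E))

  distinctPairs : List (Vertex × Vertex)
  distinctPairs = filter (λ (u , v) → ¬? (u ≟ v)) (cartesianProduct (allFin #V) (allFin #V))

-- In both, the first argument of max is the value on an empty list.
Δ : Multigraph → ℕ
Δ G = max 0 (map degree (allFin #V))
  where open Multigraph G

μ : Multigraph → ℕ
μ G = max 0 (map (λ (u , v) → multiplicity u v) distinctPairs)
  where open Multigraph G

increasingPairs : ∀ n → List (Fin n × Fin n)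
increasingPairs n = filter (λ (i , j) → i <? j) (cartesianProduct (allFin n) (allFin n))

increasingPairs-< : ∀ n → All (λ (i , j) → i Fin.< j) (increasingPairs n)
increasingPairs-< n = all-filter (λ (i , j) → i <? j) (cartesianProduct (allFin n) (allFin n))

-- The complete graph.
K : ℕ → Multigraph
K n = record
  { #V       = n
  ; #E       = length (increasingPairs n)
  ; end      = λ { e zero       → proj₁ (lookup (increasingPairs n) e)
                 ; e (suc zero) → proj₂ (lookup (increasingPairs n) e) }
  ; loopless = λ e → <⇒≢ (All.lookup (increasingPairs-< n) (∈-lookup e))
  }

-- Each edge replaced by m parallel edges: via remQuot, the edges are the pairs
-- (edge of G , copy number in Fin m).
inflate : ℕ → Multigraph → Multigraph
inflate m G = record
  { #V       = #V
  ; #E       = #E * m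
  ; end      = λ e → end (original e)
  ; loopless = λ e → loopless (original e)
  }
  where
  open Multigraph G
  original : Fin (#E * m) → Fin #E
  original e = proj₁ (remQuot {#E} m e)

record SignedMultigraph : Set where
  constructor _,ˢ_
  field
    graph : Multigraph
    σ     : Multigraph.Edge graph → Sign

  open Multigraph graph public

signℤ : Sign → ℤ
signℤ Sign.+ = + 1
signℤ Sign.- = - (+ 1)

-- c ∈M k is membership of the integer c in the color set M_k.
_∈M_ : ℤ → ℕ → Set
c ∈M k = (∃ λ r → k ≡ 2 * r     × ((- (+ r) ℤ.≤ c × c ℤ.≤ - (+ 1)) ⊎ (+ 1 ℤ.≤ c × c ℤ.≤ + r)))
       ⊎ (∃ λ r → k ≡ 2 * r + 1 × (- (+ r) ℤ.≤ c × c ℤ.≤ + r))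

record EdgeColoring (S : SignedMultigraph) (k : ℕ) : Set where
  open SignedMultigraph S
  field
    γ      : HalfEdge → ℤ
    inM    : ∀ h → γ h ∈M k
    proper : ∀ h h′ → vertexOf h ≡ vertexOf h′ → h ≢ h′ → γ h ≢ γ h′
    signed : ∀ h → γ h ≡ - (signℤ (σ (edgeOf h))) ℤ.* γ (otherHalf h)

-- χ′ S is k, i.e. k is the least number admitting an edge coloring. A relation,
-- so that no existence proof is needed to define it; k is unique by antisymmetry.
χ′_is_ : SignedMultigraph → ℕ → Set
χ′ S is k = EdgeColoring S k × (∀ j → EdgeColoring S j → k ≤ j)

{-# OPTIONS --safe #-}

-- A colour is carried by at most two negative edges, since these form a matching
-- on five vertices; so 10m - 1 negative edges need at least 5m colours. Conversely,
-- take m copies of the 5-edge-colouring of K₅ that gives the edge xy the colour x + y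
-- mod 5, for which the colour 2v mod 5 is missing at v. If the
-- positive edge uv has colour a, and b is a colour missing at v, then recolour its half
-- at v by b and name the colours so that b = - a.
module Submission where

open import Defs
open import Data.Nat.Base using (ℕ; zero; suc; _+_; _*_; _≤_; _/_; z≤n; s≤s; s≤s⁻¹)
open import Data.Sign.Base using (Sign)
open import Data.Product using (_×_; ∃!)
open import Relation.Binary.PropositionalEquality using (_≡_)

open import Data.Bool.Base using (true; false; if_then_else_)
open import Data.Fin.Base using (Fin; zero; suc; toℕ; _↑ˡ_; _↑ʳ_; punchIn; punchOut; combine; remQuot; quotient; remainder; opposite)
open import Data.Fin.Patterns using (0F; 1F)
open import Data.Fin.Permutation using (Permutation; _⟨$⟩ʳ_; insert; insert-punchIn; id)
import Data.Fin.Properties as Fin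
open import Data.Integer.Base as ℤ using (ℤ; 1ℤ; -1ℤ; -[1+_]; +0; +[1+_]; -_; +≤+; -≤-; -≤+)
import Data.Integer.Properties as ℤ
open import Data.List.Base using (List; []; _∷_; _++_; length; map; filter; lookup; tabulate; allFin; cartesianProduct)
open import Data.List.Extrema.Nat using (max; max≤v⁺; v≤max⁺)
open import Data.List.Membership.Propositional using (_∈_)
open import Data.List.Membership.Propositional.Properties using (∈-tabulate⁺; ∈-lookup)
open import Data.List.Properties using (filter-++; length-++; length-tabulate)
open import Data.List.Relation.Unary.All as All using (All; []; _∷_)
import Data.List.Relation.Unary.All.Properties as All
open import Data.List.Relation.Unary.AllPairs using ([]; _∷_)
open import Data.List.Relation.Unary.Any as Any using (here; there)
import Data.List.Relation.Unary.Any.Properties as Any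
open import Data.List.Relation.Unary.Unique.Propositional using (Unique)
import Data.List.Relation.Unary.Unique.Propositional.Properties as Unique
open import Data.Nat.DivMod using (_mod_; m*n/n≡m; /-monoˡ-≤)
open import Data.Nat.ListAction using (sum)
open import Data.Nat.Properties as ℕ using (≤-refl; ≤-trans; ≤-reflexive; +-mono-≤)
open import Data.Product.Base using (_,_; ∃-syntax; proj₁; proj₂)
open import Data.Product.Properties using (≡-dec)
open import Data.Sum.Base using (inj₁; inj₂)
open import Function.Base using (_∘_; case_of_)
open import Function.Bundles using (Injection)
open import Function.Definitions using (Injective)
open import Function.Properties.Inverse using (↔⇒↣)
open import Level using (0ℓ)
open import Relation.Binary.PropositionalEquality using (_≢_; refl; sym; trans; cong; cong₂; subst; module ≡-Reasoning)
open import Relation.Nullary using (¬_; yes; no; does; contradiction)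
open import Relation.Nullary.Decidable using (¬?; _→-dec_; toWitness; decidable-stable)
open import Relation.Unary using (Pred; Decidable)

private
  variable
    A B : Set
    k m n : ℕ

-- Counting

length-filter-∁ : {P : Pred A 0ℓ} (P? : Decidable P) (xs : List A) →
  length xs ≡ length (filter P? xs) + length (filter (¬? ∘ P?) xs)
length-filter-∁ P? []       = refl
length-filter-∁ P? (x ∷ xs) with does (P? x)
... | true  = cong suc (length-filter-∁ P? xs)
... | false = trans (cong suc (length-filter-∁ P? xs)) (sym (ℕ.+-suc _ _))

-- Pigeonhole by induction on `cs`: the elements in the fibre of the head are filtered out and
-- counted by the bound `d`, and the rest take values in the tail. The bound is required of every
-- duplicate-free list with entries in `xs`, so that it passes to the filtered list.
length≤fibers : ∀ {d} (f : A → ℤ) (cs : List ℤ) (xs : List A) → Unique xs →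
  (∀ c ys → Unique ys → All (_∈ xs) ys → All (λ y → f y ≡ c) ys → length ys ≤ d) →
  All (λ x → f x ∈ cs) xs → length xs ≤ length cs * d
length≤fibers f []       []       _  _     _        = z≤n
length≤fibers f []       (_ ∷ _)  _  _     (() ∷ _)
length≤fibers {d = d} f (c ∷ cs) xs !xs fiber f∈ = begin
  length xs                                          ≡⟨ length-filter-∁ P? xs ⟩
  length (filter P? xs) + length (filter (¬? ∘ P?) xs)
    ≤⟨ +-mono-≤
         (fiber c _ (Unique.filter⁺ P? !xs) (All.filter⁺ P? (All.tabulate λ x∈ → x∈)) (All.all-filter P? xs))
         (length≤fibers f cs _ (Unique.filter⁺ (¬? ∘ P?) !xs)
           (λ c′ ys !ys ys⊆ → fiber c′ ys !ys
             (All.map (All.lookup (All.filter⁺ (¬? ∘ P?) (All.tabulate λ x∈ → x∈))) ys⊆))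
           (All.zipWith (λ { (f≢c , here f≡c) → contradiction f≡c f≢c ; (_ , there f∈cs) → f∈cs })
             (All.all-filter (¬? ∘ P?) xs , All.filter⁺ (¬? ∘ P?) f∈))) ⟩
  d + length cs * d                                  ∎
  where
  open ℕ.≤-Reasoning
  P? : Decidable (λ x → f x ≡ c)
  P? x = f x ℤ.≟ c

lookup-injective : {xs : List A} → Unique xs → Injective _≡_ _≡_ (lookup xs)
lookup-injective (_   ∷ _) {zero}  {zero}  _  = refl
lookup-injective (x∉  ∷ _) {zero}  {suc j} eq = contradiction eq (All.lookup x∉ (∈-lookup j))
lookup-injective (x∉  ∷ _) {suc i} {zero}  eq = contradiction (sym eq) (All.lookup x∉ (∈-lookup i))
lookup-injective (_ ∷ !xs) {suc i} {suc j} eq = cong suc (lookup-injective !xs eq)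

remQuot-injective : ∀ m → Injective _≡_ _≡_ (remQuot {n} m)
remQuot-injective {n} m {i} {j} eq = begin
  i                                         ≡⟨ Fin.combine-remQuot {n} m i ⟨
  combine (quotient {n} m i) (remainder {n} m i) ≡⟨ cong (λ (q , r) → combine q r) eq ⟩
  combine (quotient {n} m j) (remainder {n} m j) ≡⟨ Fin.combine-remQuot {n} m j ⟩
  j                                         ∎
  where open ≡-Reasoning

sum-tabulate-+ : ∀ m (w : Fin (m + n) → ℕ) →
  sum (tabulate w) ≡ sum (tabulate (λ i → w (i ↑ˡ n))) + sum (tabulate (λ i → w (m ↑ʳ i)))
sum-tabulate-+ zero    w = refl
sum-tabulate-+ (suc m) w = trans (cong (w zero +_) (sum-tabulate-+ m (w ∘ suc))) (sym (ℕ.+-assoc (w zero) _ _))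

sum-tabulate-const : ∀ {c} (w : Fin m → ℕ) → (∀ i → w i ≡ c) → sum (tabulate w) ≡ m * c
sum-tabulate-const {zero}  w eq = refl
sum-tabulate-const {suc m} w eq = cong₂ _+_ (eq zero) (sum-tabulate-const (w ∘ suc) (eq ∘ suc))

sum-tabulate-cong : {v w : Fin m → ℕ} → (∀ i → v i ≡ w i) → sum (tabulate v) ≡ sum (tabulate w)
sum-tabulate-cong {zero}  eq = refl
sum-tabulate-cong {suc m} eq = cong₂ _+_ (eq zero) (sum-tabulate-cong (eq ∘ suc))

-- Each index is the quotient of a block of `m` consecutive indices; the induction splits off the
-- first block.
sum-tabulate-quotient : ∀ m (w : Fin n → ℕ) → sum (tabulate (w ∘ quotient m)) ≡ m * sum (tabulate w)
sum-tabulate-quotient {zero}  m w = sym (ℕ.*-zeroʳ m)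
sum-tabulate-quotient {suc n} m w = begin
  sum (tabulate (w ∘ quotient m))
    ≡⟨ sum-tabulate-+ m _ ⟩
  sum (tabulate (λ i → w (quotient m (i ↑ˡ n * m)))) + sum (tabulate (λ i → w (quotient m (m ↑ʳ i))))
    ≡⟨ cong₂ _+_ (sum-tabulate-const {m} _ (λ i → cong (λ qr → w (proj₁ qr)) (Fin.remQuot-combine {suc n} zero i)))
                 (sum-tabulate-cong (λ i → cong w (quotient-↑ʳ i))) ⟩
  m * w zero + sum (tabulate (λ i → w (suc (quotient {n} m i))))
    ≡⟨ cong (m * w zero +_) (sum-tabulate-quotient m (w ∘ suc)) ⟩
  m * w zero + m * sum (tabulate (w ∘ suc))
    ≡⟨ ℕ.*-distribˡ-+ m (w zero) _ ⟨
  m * (w zero + sum (tabulate (w ∘ suc)))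
    ∎
  where
  open ≡-Reasoning
  quotient-↑ʳ : (i : Fin (n * m)) → quotient {suc n} m (m ↑ʳ i) ≡ suc (quotient m i)
  quotient-↑ʳ i rewrite Fin.splitAt-↑ʳ m (n * m) i = refl

length-filter-tabulate : {P : Pred A 0ℓ} (P? : Decidable P) (f : Fin n → A) →
  length (filter P? (tabulate f)) ≡ sum (tabulate (λ i → if does (P? (f i)) then 1 else 0))
length-filter-tabulate {n = zero}  P? f = refl
length-filter-tabulate {n = suc n} P? f with does (P? (f zero))
... | true  = cong suc (length-filter-tabulate P? (f ∘ suc))
... | false = length-filter-tabulate P? (f ∘ suc)

length-filter-map : {P : Pred B 0ℓ} (P? : Decidable P) (f : A → B) (xs : List A) →
  length (filter P? (map f xs)) ≡ length (filter (P? ∘ f) xs)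
length-filter-map P? f []       = refl
length-filter-map P? f (x ∷ xs) with does (P? (f x))
... | true  = cong suc (length-filter-map P? f xs)
... | false = length-filter-map P? f xs

-- Grouping by first component turns a count of half-edges into a sum over edges, the form that
-- `sum-tabulate-quotient` handles.
length-filter-cartesianProduct : {P : Pred (A × B) 0ℓ} (P? : Decidable P) (f : Fin n → A) (ys : List B) →
  length (filter P? (cartesianProduct (tabulate f) ys)) ≡
  sum (tabulate (λ i → length (filter (λ y → P? (f i , y)) ys)))
length-filter-cartesianProduct {n = zero}  P? f ys = refl
length-filter-cartesianProduct {n = suc n} P? f ys = begin
  length (filter P? (map (f zero ,_) ys ++ rest))
    ≡⟨ cong length (filter-++ P? (map (f zero ,_) ys) rest) ⟩
  length (filter P? (map (f zero ,_) ys) ++ filter P? rest)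
    ≡⟨ length-++ (filter P? (map (f zero ,_) ys)) ⟩
  length (filter P? (map (f zero ,_) ys)) + length (filter P? rest)
    ≡⟨ cong₂ _+_ (length-filter-map P? (f zero ,_) ys) (length-filter-cartesianProduct P? (f ∘ suc) ys) ⟩
  _ ∎
  where
  open ≡-Reasoning
  rest = cartesianProduct (tabulate (f ∘ suc)) ys

-- Degrees and multiplicities

-- The default 0 is harmless for the upper bound; the lower bound comes from the member `x`.
max-const : ∀ {c x} (f : A → ℕ) (xs : List A) → x ∈ xs →
  All (λ y → f y ≡ c) xs → max 0 (map f xs) ≡ c
max-const f xs x∈xs eqs = ℕ.≤-antisym
  (max≤v⁺ z≤n (All.map⁺ (All.map ≤-reflexive eqs)))
  (v≤max⁺ 0 (map f xs) (inj₂ (Any.map⁺ (Any.map (λ { refl → ≤-reflexive (sym (All.lookup eqs x∈xs)) }) x∈xs))))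

-- Stated for a variable G because the conversion checker would unfold the maxima of
-- a concrete one, at prohibitive cost.
module _ (G : Multigraph) where
  open Multigraph G

  Δ-const : ∀ {c v} → v ∈ allFin #V → All (λ v → degree v ≡ c) (allFin #V) → Δ G ≡ c
  Δ-const = max-const degree (allFin #V)

  μ-const : ∀ {c p} → p ∈ distinctPairs → All (λ (u , v) → multiplicity u v ≡ c) distinctPairs → μ G ≡ c
  μ-const = max-const (λ (u , v) → multiplicity u v) distinctPairs

module _ (m : ℕ) (G : Multigraph) where
  open Multigraph G
  private module mG = Multigraph (inflate m G)

  -- The number of ends that an edge has at `v` depends only on the original edge, so the count is a
  -- sum over quotients.
  degree-inflate : ∀ v → mG.degree v ≡ m * degree v
  degree-inflate v = begin
    mG.degree v
      ≡⟨ length-filter-cartesianProduct (λ h → mG.vertexOf h Fin.≟ v) (λ e → e) (allFin 2) ⟩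
    sum (tabulate (weight ∘ quotient m))
      ≡⟨ sum-tabulate-quotient m weight ⟩
    m * sum (tabulate weight)
      ≡⟨ cong (m *_) (length-filter-cartesianProduct (λ h → vertexOf h Fin.≟ v) (λ e → e) (allFin 2)) ⟨
    m * degree v
      ∎
    where
    open ≡-Reasoning
    weight : Edge → ℕ
    weight e = length (filter (λ i → end e i Fin.≟ v) (allFin 2))

  multiplicity-inflate : ∀ u v → mG.multiplicity u v ≡ m * multiplicity u v
  multiplicity-inflate u v = begin
    mG.multiplicity u v                  ≡⟨ length-filter-tabulate (mG.joins? u v) (λ e → e) ⟩
    sum (tabulate (weight ∘ quotient m)) ≡⟨ sum-tabulate-quotient m weight ⟩
    m * sum (tabulate weight)            ≡⟨ cong (m *_) (length-filter-tabulate (joins? u v) (λ e → e)) ⟨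
    m * multiplicity u v                 ∎
    where
    open ≡-Reasoning
    weight : Edge → ℕ
    weight e = if does (joins? u v e) then 1 else 0

private module K₅ = Multigraph (K 5)

K₅-degree : All (λ v → K₅.degree v ≡ 4) (allFin 5)
K₅-degree = toWitness {a? = All.all? (λ v → K₅.degree v ℕ.≟ 4) (allFin 5)} _

K₅-multiplicity : All (λ (u , v) → K₅.multiplicity u v ≡ 1) K₅.distinctPairs
K₅-multiplicity = toWitness {a? = All.all? (λ (u , v) → K₅.multiplicity u v ℕ.≟ 1) K₅.distinctPairs} _

Δ-inflate-K₅ : ∀ m → Δ (inflate m (K 5)) ≡ m * 4
Δ-inflate-K₅ m = Δ-const (inflate m (K 5)) (here refl)
  (All.map (λ {v} eq → trans (degree-inflate m (K 5) v) (cong (m *_) eq)) K₅-degree)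

μ-inflate-K₅ : ∀ m → μ (inflate m (K 5)) ≡ m * 1
μ-inflate-K₅ m = μ-const (inflate m (K 5)) (here refl)
  (All.map (λ {(u , v)} eq → trans (multiplicity-inflate m (K 5) u v) (cong (m *_) eq)) K₅-multiplicity)

Δ+μ≡5m : ∀ G → Δ G ≡ m * 4 → μ G ≡ m * 1 → Δ G + μ G ≡ 5 * m
Δ+μ≡5m {m} G Δ≡4m μ≡m = begin
  Δ G + μ G     ≡⟨ cong₂ _+_ Δ≡4m μ≡m ⟩
  m * 4 + m * 1 ≡⟨ ℕ.*-distribˡ-+ m 4 1 ⟨
  m * 5         ≡⟨ ℕ.*-comm m 5 ⟩
  5 * m         ∎
  where open ≡-Reasoning

Δ+μ-inflate-K₅ : ∀ m → Δ (inflate m (K 5)) + μ (inflate m (K 5)) ≡ 5 * m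
Δ+μ-inflate-K₅ m = Δ+μ≡5m {m} (inflate m (K 5)) (Δ-inflate-K₅ m) (μ-inflate-K₅ m)

-- The colour set M

-- Maps M_k onto M_(k+2) without 1 and -1, which lets `color` recurse in steps of two for both
-- parities.
awayFrom0 : ℤ → ℤ
awayFrom0 +0       = +0
awayFrom0 +[1+ n ] = +[1+ suc n ]
awayFrom0 -[1+ n ] = -[1+ suc n ]

awayFrom0-injective : Injective _≡_ _≡_ awayFrom0
awayFrom0-injective {+0}       {+0}       _    = refl
awayFrom0-injective {+[1+ _ ]} {+[1+ _ ]} refl = refl
awayFrom0-injective { -[1+ _ ]} { -[1+ _ ]} refl = refl
awayFrom0-injective {+0}       {+[1+ _ ]} ()
awayFrom0-injective {+[1+ _ ]} {+0}       ()
awayFrom0-injective { -[1+ _ ]} {+0}       ()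
awayFrom0-injective { -[1+ _ ]} {+[1+ _ ]} ()

awayFrom0≢1 : ∀ c → 1ℤ ≢ awayFrom0 c
awayFrom0≢1 +0       ()
awayFrom0≢1 +[1+ _ ] ()
awayFrom0≢1 -[1+ _ ] ()

awayFrom0≢-1 : ∀ c → -1ℤ ≢ awayFrom0 c
awayFrom0≢-1 +0       ()
awayFrom0≢-1 +[1+ _ ] ()
awayFrom0≢-1 -[1+ _ ] ()

-- The order 1, -1, 2, -2, …, with 0 at the end if k is odd.
color : ∀ k → Fin k → ℤ
color (suc zero)    zero          = +0
color (suc (suc k)) zero          = 1ℤ
color (suc (suc k)) (suc zero)    = -1ℤ
color (suc (suc k)) (suc (suc i)) = awayFrom0 (color k i)

color-injective : ∀ k → Injective _≡_ _≡_ (color k)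
color-injective (suc zero)    {zero}        {zero}        _  = refl
color-injective (suc (suc k)) {zero}        {zero}        _  = refl
color-injective (suc (suc k)) {zero}        {suc (suc j)} eq = contradiction eq (awayFrom0≢1 (color k j))
color-injective (suc (suc k)) {suc zero}    {suc zero}    _  = refl
color-injective (suc (suc k)) {suc zero}    {suc (suc j)} eq = contradiction eq (awayFrom0≢-1 (color k j))
color-injective (suc (suc k)) {suc (suc i)} {zero}        eq = contradiction (sym eq) (awayFrom0≢1 (color k i))
color-injective (suc (suc k)) {suc (suc i)} {suc zero}    eq = contradiction (sym eq) (awayFrom0≢-1 (color k i))
color-injective (suc (suc k)) {suc (suc i)} {suc (suc j)} eq =
  cong (λ l → suc (suc l)) (color-injective k (awayFrom0-injective eq))

2+2r≡2[1+r] : ∀ {r} → k ≡ 2 * r → 2 + k ≡ 2 * suc r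
2+2r≡2[1+r] {r = r} eq = trans (cong (2 +_) eq) (sym (ℕ.*-suc 2 r))

2+2r+1≡2[1+r]+1 : ∀ {r} → k ≡ 2 * r + 1 → 2 + k ≡ 2 * suc r + 1
2+2r+1≡2[1+r]+1 {r = r} eq = trans (cong (2 +_) eq) (cong (_+ 1) (sym (ℕ.*-suc 2 r)))

-- The recursion serves only to find the parity of `k` and the radius `r`; the bounds themselves are
-- immediate once `r` is positive.
1∈M : ∀ k → 1ℤ ∈M (2 + k)
-1∈M : ∀ k → -1ℤ ∈M (2 + k)
1∈M zero          = inj₁ (1 , refl , inj₂ (≤1 , ≤1)) where ≤1 = +≤+ (s≤s z≤n)
1∈M (suc zero)    = inj₂ (1 , refl , -≤+ , +≤+ (s≤s z≤n))
1∈M (suc (suc k)) with 1∈M k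
... | inj₁ (r , eq , _) = inj₁ (suc r , 2+2r≡2[1+r] eq , inj₂ (+≤+ (s≤s z≤n) , +≤+ (s≤s z≤n)))
... | inj₂ (r , eq , _) = inj₂ (suc r , 2+2r+1≡2[1+r]+1 eq , -≤+ , +≤+ (s≤s z≤n))
-1∈M zero          = inj₁ (1 , refl , inj₁ (-≤- z≤n , -≤- z≤n))
-1∈M (suc zero)    = inj₂ (1 , refl , -≤- z≤n , -≤+)
-1∈M (suc (suc k)) with -1∈M k
... | inj₁ (r , eq , _) = inj₁ (suc r , 2+2r≡2[1+r] eq , inj₁ (-≤- z≤n , -≤- z≤n))
... | inj₂ (r , eq , _) = inj₂ (suc r , 2+2r+1≡2[1+r]+1 eq , -≤- z≤n , -≤+)

awayFrom0-≤ : ∀ {r} c → - ℤ.+ r ℤ.≤ c → - ℤ.+ suc r ℤ.≤ awayFrom0 c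
awayFrom0-≤         +0       _         = -≤+
awayFrom0-≤         +[1+ _ ] _         = -≤+
awayFrom0-≤ {zero}  -[1+ _ ] ()
awayFrom0-≤ {suc r} -[1+ _ ] (-≤- n≤r) = -≤- (s≤s n≤r)

≤-awayFrom0 : ∀ {r} c → c ℤ.≤ ℤ.+ r → awayFrom0 c ℤ.≤ ℤ.+ suc r
≤-awayFrom0 +0       _         = +≤+ z≤n
≤-awayFrom0 +[1+ _ ] (+≤+ n≤r) = +≤+ (s≤s n≤r)
≤-awayFrom0 -[1+ _ ] _         = -≤+

awayFrom0-∈M : ∀ c → c ∈M k → awayFrom0 c ∈M (2 + k)
awayFrom0-∈M c (inj₂ (r , eq , lo , hi)) =
  inj₂ (suc r , 2+2r+1≡2[1+r]+1 eq , awayFrom0-≤ c lo , ≤-awayFrom0 c hi)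
awayFrom0-∈M c@(+[1+ _ ]) (inj₁ (r , eq , inj₂ (_ , hi))) =
  inj₁ (suc r , 2+2r≡2[1+r] eq , inj₂ (+≤+ (s≤s z≤n) , ≤-awayFrom0 c hi))
awayFrom0-∈M c@(-[1+ _ ]) (inj₁ (r , eq , inj₁ (lo , _))) =
  inj₁ (suc r , 2+2r≡2[1+r] eq , inj₁ (awayFrom0-≤ c lo , -≤- z≤n))
awayFrom0-∈M +0       (inj₁ (_ , _ , inj₁ (_ , ())))
awayFrom0-∈M +0       (inj₁ (_ , _ , inj₂ (+≤+ () , _)))
awayFrom0-∈M +[1+ _ ] (inj₁ (_ , _ , inj₁ (_ , ())))
awayFrom0-∈M -[1+ _ ] (inj₁ (_ , _ , inj₂ (() , _)))

color-∈M : ∀ k i → color k i ∈M k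
color-∈M (suc zero)    zero          = inj₂ (0 , refl , +≤+ z≤n , +≤+ z≤n)
color-∈M (suc (suc k)) zero          = 1∈M k
color-∈M (suc (suc k)) (suc zero)    = -1∈M k
color-∈M (suc (suc k)) (suc (suc i)) = awayFrom0-∈M (color k i) (color-∈M k i)

color-surjective-0 : ∀ k r → k ≡ 2 * r + 1 → ∃[ i ] color k i ≡ +0
color-surjective-0 zero          zero    ()
color-surjective-0 zero          (suc r) ()
color-surjective-0 (suc zero)    _       _  = zero , refl
color-surjective-0 (suc (suc k)) zero    ()
color-surjective-0 (suc (suc k)) (suc r) eq =
  let i , eqᵢ = color-surjective-0 k r (ℕ.suc-injective (ℕ.suc-injective (trans eq (cong (_+ 1) (ℕ.*-suc 2 r)))))
  in suc (suc i) , cong awayFrom0 eqᵢ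

2[1+n]≤2+k⇒2n≤k : ∀ n → 2 * suc n ≤ 2 + k → 2 * n ≤ k
2[1+n]≤2+k⇒2n≤k {k} n le = ℕ.+-cancelˡ-≤ 2 _ _ (subst (_≤ 2 + k) (ℕ.*-suc 2 n) le)

2[1+n]≰1 : ∀ n → ¬ 2 * suc n ≤ 1
2[1+n]≰1 n le = case subst (_≤ 1) (ℕ.*-suc 2 n) le of λ { (s≤s ()) }

-- The hypothesis is the condition, for either parity of `k`, that n + 1 belongs to M_k. One step of
-- `awayFrom0` lowers `n` by 1 and `k` by 2.
color-surjective-+ : ∀ k n → 2 * suc n ≤ k → ∃[ i ] color k i ≡ +[1+ n ]
color-surjective-+ (suc (suc k)) zero    _    = zero , refl
color-surjective-+ (suc (suc k)) (suc n) 2n≤k =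
  let i , eq = color-surjective-+ k n (2[1+n]≤2+k⇒2n≤k (suc n) 2n≤k)
  in suc (suc i) , cong awayFrom0 eq
color-surjective-+ (suc zero)    n       2n≤k = contradiction 2n≤k (2[1+n]≰1 n)

color-surjective-- : ∀ k n → 2 * suc n ≤ k → ∃[ i ] color k i ≡ -[1+ n ]
color-surjective-- (suc (suc k)) zero    _    = suc zero , refl
color-surjective-- (suc (suc k)) (suc n) 2n≤k =
  let i , eq = color-surjective-- k n (2[1+n]≤2+k⇒2n≤k (suc n) 2n≤k)
  in suc (suc i) , cong awayFrom0 eq
color-surjective-- (suc zero)    n       2n≤k = contradiction 2n≤k (2[1+n]≰1 n)

color-surjective : ∀ k c → c ∈M k → ∃[ i ] color k i ≡ c
color-surjective k +0       (inj₁ (_ , _ , inj₁ (_ , ())))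
color-surjective k +0       (inj₁ (_ , _ , inj₂ (+≤+ () , _)))
color-surjective k +0       (inj₂ (r , eq , _)) = color-surjective-0 k r eq
color-surjective k +[1+ n ] (inj₁ (_ , _ , inj₁ (_ , ())))
color-surjective k +[1+ n ] (inj₁ (r , refl , inj₂ (_ , +≤+ n<r))) =
  color-surjective-+ k n (ℕ.*-monoʳ-≤ 2 n<r)
color-surjective k +[1+ n ] (inj₂ (r , refl , _ , +≤+ n<r)) =
  color-surjective-+ k n (≤-trans (ℕ.*-monoʳ-≤ 2 n<r) (ℕ.m≤m+n _ 1))
color-surjective k -[1+ n ] (inj₁ (_ , _ , inj₂ (() , _)))
color-surjective k -[1+ n ] (inj₁ (suc r , refl , inj₁ (-≤- n≤r , _))) =
  color-surjective-- k n (ℕ.*-monoʳ-≤ 2 (s≤s n≤r))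
color-surjective k -[1+ n ] (inj₂ (suc r , refl , -≤- n≤r , _)) =
  color-surjective-- k n (≤-trans (ℕ.*-monoʳ-≤ 2 (s≤s n≤r)) (ℕ.m≤m+n _ 1))

-- Presents M_k as covered by a list of length `k`, over which the lower bound sums its colour
-- classes.
∈M⇒∈colors : ∀ k c → c ∈M k → c ∈ tabulate (color k)
∈M⇒∈colors k c c∈M = let i , eq = color-surjective k c c∈M in
  subst (_∈ tabulate (color k)) eq (∈-tabulate⁺ i)

-- Naming abstract colours by integers

record Palette {k : ℕ} (a b : Fin k) : Set where
  field
    name           : Fin k → ℤ
    name-injective : Injective _≡_ _≡_ name
    name-∈M        : ∀ i → name i ∈M k
    opposed        : name b ≡ - name a

-- Both halves of a negative edge get the same colour, so only the two colours on the positive edge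
-- constrain the names. Since `a` and `b` differ, `k` is at least 2 and M_k contains 1 and -1, which
-- become their names.
palette : (a b : Fin k) → a ≢ b → Palette a b
palette {suc zero}    zero zero a≢b = contradiction refl a≢b
palette {suc (suc k)} a    b    a≢b = record
  { name           = color _ ∘ (π ⟨$⟩ʳ_)
  ; name-injective = Injection.injective (↔⇒↣ π) ∘ color-injective _
  ; name-∈M        = λ i → color-∈M _ (π ⟨$⟩ʳ i)
  ; opposed        = trans (cong (color _) πb≡1) (cong (-_ ∘ color _) (sym πa≡0))
  }
  where
  -- `π₁` sends `b`, renumbered after the removal of `a`, to 0. Hence `π` sends `a` to 0 and `b` to
  -- 1, the positions of 1 and -1 in `color`.
  π₁ : Permutation (suc k) (suc k)
  π₁ = insert (punchOut a≢b) zero id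

  π : Permutation (2 + k) (2 + k)
  π = insert a zero π₁

  insert-i : ∀ {n} (i j : Fin (suc n)) (ρ : Permutation n n) → insert i j ρ ⟨$⟩ʳ i ≡ j
  insert-i i j ρ with i Fin.≟ i
  ... | yes _   = refl
  ... | no  i≢i = contradiction refl i≢i

  πa≡0 : π ⟨$⟩ʳ a ≡ zero
  πa≡0 = insert-i a zero π₁

  πb≡1 : π ⟨$⟩ʳ b ≡ suc zero
  πb≡1 = begin
    π ⟨$⟩ʳ b                            ≡⟨ cong (π ⟨$⟩ʳ_) (Fin.punchIn-punchOut a≢b) ⟨
    π ⟨$⟩ʳ punchIn a (punchOut a≢b)     ≡⟨ insert-punchIn a zero π₁ (punchOut a≢b) ⟩
    suc (π₁ ⟨$⟩ʳ punchOut a≢b)          ≡⟨ cong suc (insert-i (punchOut a≢b) zero id) ⟩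
    suc zero                            ∎
    where open ≡-Reasoning

-- The lower bound

module _ (S : SignedMultigraph) where
  open SignedMultigraph S

  module _ (C : EdgeColoring S k) where
    open EdgeColoring C

    -- The edges form a matching: the two halves of each of them give distinct half-edges of one
    -- colour, so properness makes the map from these half-edges to their vertices injective.
    monochromatic≤ : ∀ {c} (es : List Edge) → Unique es →
      All (λ e → ∀ s → γ (e , s) ≡ c) es → length es * 2 ≤ #V
    monochromatic≤ es !es γ≡c = Fin.injective⇒≤ {f = λ i → vertexOf (half i)} λ {i} {j} eq →
      -- Properness only refutes that the half-edges differ; decidable equality turns this into
      -- equality.
      let h≡h′ = decidable-stable (≡-dec Fin._≟_ Fin._≟_ (half i) (half j))
                   (λ h≢h′ → proper _ _ eq h≢h′ (trans (γ-half i) (sym (γ-half j))))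
      in remQuot-injective {length es} 2
           (cong₂ _,_ (lookup-injective !es (cong proj₁ h≡h′)) (cong proj₂ h≡h′))
      where
      half : Fin (length es * 2) → HalfEdge
      half i = lookup es (quotient {length es} 2 i) , remainder {length es} 2 i

      γ-half : ∀ i → γ (half i) ≡ _
      γ-half i = All.lookup γ≡c (∈-lookup (quotient {length es} 2 i)) _

    -- The factor in the sign rule is 1 on a negative edge, so such an edge has a single colour,
    -- that of its half `0F`.
    γ-negative : ∀ e → σ e ≡ Sign.- → ∀ s → γ (e , s) ≡ γ (e , 0F)
    γ-negative e σe≡- 0F = refl
    γ-negative e σe≡- 1F = begin
      γ (e , 1F)                          ≡⟨ signed (e , 1F) ⟩
      - signℤ (σ e) ℤ.* γ (e , 0F)        ≡⟨ cong (λ s → - signℤ s ℤ.* γ (e , 0F)) σe≡- ⟩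
      1ℤ ℤ.* γ (e , 0F)                  ≡⟨ ℤ.*-identityˡ _ ⟩
      γ (e , 0F)                          ∎
      where open ≡-Reasoning

    -- Each colour class of negative edges is a matching and has at most half as many edges as there
    -- are vertices, rounded down; there are `k` classes.
    negativeEdges≤ : (es : List Edge) → Unique es → All (λ e → σ e ≡ Sign.-) es →
      length es ≤ k * (#V / 2)
    negativeEdges≤ es !es neg = subst (λ l → length es ≤ l * (#V / 2)) (length-tabulate (color k))
      (length≤fibers (λ e → γ (e , 0F)) (tabulate (color k)) es !es
        (λ c ys !ys ys⊆es γ≡c →
          subst (_≤ #V / 2) (m*n/n≡m (length ys) 2) (/-monoˡ-≤ 2 (monochromatic≤ ys !ys
            (All.zipWith (λ { (e∈ , eq) s → trans (γ-negative _ (All.lookup neg e∈) s) eq })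
              (ys⊆es , γ≡c)))))
        (All.tabulate λ {e} _ → ∈M⇒∈colors k _ (inM (e , 0F))))

≢+⇒≡- : ∀ s → s ≢ Sign.+ → s ≡ Sign.-
≢+⇒≡- Sign.- _   = refl
≢+⇒≡- Sign.+ s≢+ = contradiction refl s≢+

chromaticIndex≥ : ∀ m (σ : Fin (10 * suc m) → Sign) → ∃! _≡_ (λ e → σ e ≡ Sign.+) →
  ∀ j → EdgeColoring (inflate (suc m) (K 5) ,ˢ σ) j → 5 * suc m ≤ j
chromaticIndex≥ m σ (e₀ , _ , unique) j C =
  -- Parity makes up for the positive edge: `10 * suc m` is at most `j * 2 + 1`, hence strictly
  -- below `suc j * 2`, and halving gives `5 * suc m < suc j`.
  s≤s⁻¹ (ℕ.*-cancelʳ-< 2 (5 * suc m) (suc j) (begin-strict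
    5 * suc m * 2      ≡⟨ ℕ.*-comm (5 * suc m) 2 ⟩
    2 * (5 * suc m)    ≡⟨ ℕ.*-assoc 2 5 (suc m) ⟨
    -- `punchIn e₀` runs through all edges but `e₀`, hence through exactly the negative ones.
    10 * suc m         ≡⟨ cong suc (length-tabulate (punchIn e₀)) ⟨
    suc (length negs)  ≤⟨ s≤s (negativeEdges≤ _ C negs
                            (Unique.tabulate⁺ (Fin.punchIn-injective e₀ _ _))
                            (All.tabulate⁺ λ i → ≢+⇒≡- _ λ +ᵢ → Fin.punchInᵢ≢i e₀ i (sym (unique +ᵢ)))) ⟩
    suc (j * 2)        <⟨ ≤-refl ⟩
    suc j * 2          ∎))
  where
  open ℕ.≤-Reasoning
  negs = tabulate (punchIn e₀)

-- Colouring with one positive edge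

module _ (m : ℕ) (G : Multigraph) {q : ℕ}
  (c : Multigraph.Edge G → Fin q) (missing : Multigraph.Vertex G → Fin q)
  (c-proper : ∀ e e′ s s′ → Multigraph.end G e s ≡ Multigraph.end G e′ s′ → c e ≡ c e′ → e ≡ e′)
  (c≢missing : ∀ e s → c e ≢ missing (Multigraph.end G e s))
  where
  open Multigraph G using (#E)
  private module mG = Multigraph (inflate m G)

  -- A colour is a pair of a colour of `G` and a copy number, so distinct copies of `G` use disjoint
  -- sets of colours.
  copiedColor : mG.Edge → Fin (q * m)
  copiedColor e = combine (c (quotient m e)) (remainder {#E} m e)

  -- Equal pairs have equal copy numbers and equal base colours; `c-proper` then identifies the
  -- edges, and looplessness the halves.
  copiedColor-proper : ∀ h h′ → mG.vertexOf h ≡ mG.vertexOf h′ →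
    copiedColor (mG.edgeOf h) ≡ copiedColor (mG.edgeOf h′) → h ≡ h′
  copiedColor-proper (e , s) (e′ , s′) v≡v′ c≡c′
    with base≡ , copy≡ ← Fin.combine-injective
                           (c (quotient m e))  (remainder {#E} m e)
                           (c (quotient m e′)) (remainder {#E} m e′) c≡c′
    with refl ← remQuot-injective {#E} m
                  (cong₂ _,_ (c-proper (quotient m e) (quotient m e′) s s′ v≡v′ base≡) copy≡)
    = cong (e ,_) (end-injective s s′ v≡v′)
    where
    end-injective : ∀ s s′ → mG.end e s ≡ mG.end e s′ → s ≡ s′
    end-injective 0F 0F _  = refl
    end-injective 0F 1F eq = contradiction eq (mG.loopless e)
    end-injective 1F 0F eq = contradiction (sym eq) (mG.loopless e)
    end-injective 1F 1F _  = refl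

  module _ (e₀ : mG.Edge) where
    h₀ : mG.HalfEdge
    h₀ = e₀ , 1F

    -- The colour missing at the vertex of `h₀`, taken in the copy of `G` that contains `e₀`.
    freeColor : Fin (q * m)
    freeColor = combine (missing (mG.vertexOf h₀)) (remainder {#E} m e₀)

    -- Equality would carry over to the base colours, against `c≢missing`. The case of `h₀` itself
    -- shows that the new colour of this half differs from its old one.
    freeColor-missing : ∀ h → mG.vertexOf h ≡ mG.vertexOf h₀ → copiedColor (mG.edgeOf h) ≢ freeColor
    freeColor-missing (e , s) v≡v₀ c≡b = c≢missing (quotient m e) s
      (trans (Fin.combine-injectiveˡ _ (remainder {#E} m e) _ (remainder {#E} m e₀) c≡b)
             (cong missing (sym v≡v₀)))

    halfColor : mG.HalfEdge → Fin (q * m)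
    halfColor h with ≡-dec Fin._≟_ Fin._≟_ h h₀
    ... | yes _ = freeColor
    ... | no  _ = copiedColor (mG.edgeOf h)

    halfColor-proper : ∀ h h′ → mG.vertexOf h ≡ mG.vertexOf h′ → halfColor h ≡ halfColor h′ → h ≡ h′
    halfColor-proper h h′ v≡v′ c≡c′ with ≡-dec Fin._≟_ Fin._≟_ h h₀ | ≡-dec Fin._≟_ Fin._≟_ h′ h₀
    ... | yes refl | yes refl = refl
    ... | yes refl | no _     = contradiction (sym c≡c′) (freeColor-missing h′ (sym v≡v′))
    ... | no _     | yes refl = contradiction c≡c′ (freeColor-missing h v≡v′)
    ... | no _     | no _     = copiedColor-proper h h′ v≡v′ c≡c′

    halfColor-h₀ : halfColor h₀ ≡ freeColor
    halfColor-h₀ with ≡-dec Fin._≟_ Fin._≟_ h₀ h₀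
    ... | yes _   = refl
    ... | no  h≢h = contradiction refl h≢h

    halfColor-≢h₀ : ∀ h → h ≢ h₀ → halfColor h ≡ copiedColor (mG.edgeOf h)
    halfColor-≢h₀ h h≢h₀ with ≡-dec Fin._≟_ Fin._≟_ h h₀
    ... | yes h≡h₀ = contradiction h≡h₀ h≢h₀
    ... | no  _    = refl

    -- Away from `e₀` the two halves share a colour, as negative edges require. On `e₀` they have
    -- the two colours that the palette makes opposite.
    inflate-coloring : (σ : mG.Edge → Sign) → σ e₀ ≡ Sign.+ → (∀ e → e ≢ e₀ → σ e ≡ Sign.-) →
      EdgeColoring (inflate m G ,ˢ σ) (q * m)
    inflate-coloring σ σ₀ σ₋ = record
      { γ      = γ
      ; inM    = name-∈M ∘ halfColor
      ; proper = λ h h′ v≡v′ h≢h′ → h≢h′ ∘ halfColor-proper h h′ v≡v′ ∘ name-injective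
      ; signed = signed
      }
      where
      open Palette (palette (copiedColor e₀) freeColor (freeColor-missing h₀ refl))

      γ : mG.HalfEdge → ℤ
      γ = name ∘ halfColor

      γ-e₀ : γ (e₀ , 1F) ≡ - γ (e₀ , 0F)
      γ-e₀ = trans (cong name halfColor-h₀)
               (trans opposed (cong (-_ ∘ name) (sym (halfColor-≢h₀ (e₀ , 0F) λ ()))))

      signed₊ : ∀ s → γ (e₀ , s) ≡ - γ (e₀ , opposite s)
      -- The rule at the first half is the rule at the second, negated.
      signed₊ 0F = trans (sym (ℤ.neg-involutive _)) (cong -_ (sym γ-e₀))
      signed₊ 1F = γ-e₀

      signed₋ : ∀ e s → e ≢ e₀ → γ (e , s) ≡ γ (e , opposite s)
      signed₋ e s e≢e₀ = cong name (trans (halfColor-≢h₀ (e , s) (e≢e₀ ∘ cong proj₁))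
                                     (sym (halfColor-≢h₀ (e , opposite s) (e≢e₀ ∘ cong proj₁))))

      signed : ∀ h → γ h ≡ - signℤ (σ (mG.edgeOf h)) ℤ.* γ (mG.otherHalf h)
      signed h@(e , s) = case e Fin.≟ e₀ of λ where
          (yes refl) → trans (trans (signed₊ s) (sym (ℤ.-1*i≡-i _))) (sym (unfold-sign σ₀))
          (no e≢e₀)  → trans (trans (signed₋ e s e≢e₀) (sym (ℤ.*-identityˡ _))) (sym (unfold-sign (σ₋ e e≢e₀)))
        where
        unfold-sign : ∀ {t} → σ e ≡ t → - signℤ (σ e) ℤ.* γ (mG.otherHalf h) ≡ - signℤ t ℤ.* γ (mG.otherHalf h)
        unfold-sign = cong (λ t → - signℤ t ℤ.* γ (mG.otherHalf h))

-- The colouring of K₅ and the conclusion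

K₅-color : K₅.Edge → Fin 5
K₅-color e = (toℕ (K₅.end e 0F) + toℕ (K₅.end e 1F)) mod 5

missing : Fin 5 → Fin 5
missing v = (2 * toℕ v) mod 5

-- If v + x = 2v mod 5 then x = v, which no edge vx allows. The finitely many cases are decided by
-- evaluation.
K₅-color≢missing : ∀ e s → K₅-color e ≢ missing (K₅.end e s)
K₅-color≢missing = toWitness
  {a? = Fin.all? λ e → Fin.all? λ s → ¬? (K₅-color e Fin.≟ missing (K₅.end e s))} _

-- For edges vx and vy, v + x = v + y mod 5 forces x = y; again decided by evaluation.
K₅-color-proper : ∀ e e′ s s′ → K₅.end e s ≡ K₅.end e′ s′ → K₅-color e ≡ K₅-color e′ → e ≡ e′
K₅-color-proper = toWitness
  {a? = Fin.all? λ e → Fin.all? λ e′ → Fin.all? λ s → Fin.all? λ s′ →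
        (K₅.end e s Fin.≟ K₅.end e′ s′) →-dec (K₅-color e Fin.≟ K₅-color e′) →-dec (e Fin.≟ e′)} _

mainTheorem2 : (m : ℕ) → 1 ≤ m →
    let G = inflate m (K 5) in
    (σ : Multigraph.Edge G → Sign) →
    ∃! _≡_ (λ e → σ e ≡ Sign.+) →
    (χ′ (G ,ˢ σ) is (Δ G + μ G)) × (Δ G + μ G ≡ 5 * m)
mainTheorem2 m@(suc m-1) _ σ ∃!+@(e₀ , σ₀ , unique) =
    -- Both bounds are proved for `5 * m` and carried over to the sum of maximum degree and
    -- multiplicity.
    subst (χ′ (inflate m (K 5) ,ˢ σ) is_) (sym (Δ+μ-inflate-K₅ m))
      (coloring , chromaticIndex≥ m-1 σ ∃!+)
  , Δ+μ-inflate-K₅ m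
  where
  coloring : EdgeColoring (inflate m (K 5) ,ˢ σ) (5 * m)
  coloring = inflate-coloring m (K 5) K₅-color missing K₅-color-proper K₅-color≢missing
    e₀ σ σ₀ (λ e e≢e₀ → ≢+⇒≡- (σ e) (e≢e₀ ∘ sym ∘ unique))
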